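{- For $n \ge 3$, the sun graph $S_n$ has $h(S_n) = n+2$ if $n$ is even, and $h(S_n) = n+3$ if $n$ is odd.
   Context: All graphs are finite, simple and undirected. A harmonious coloring of a graph $G$ with $k$ colors is a proper vertex coloring $c : V(G) \to \{1,\dots,k\}$ such that for every two distinct colors $i,j$ there is at most one pair of adjacent vertices colored with $i$ and $j$. The harmonious chromatic number $h(G)$ is the minimum positive integer $k$ for which $G$ has a harmonious coloring with $k$ colors. The sun graph $S_n$ is obtained from the complete graph $K_n$ on vertices $v_1,\dots,v_n$ by adding $n$ new vertices $u_1,\dots,u_n$, where $u_i$ is adjacent to exactly $v_i$ and $v_{i+1}$ for $1 \le i \le n-1$, and $u_n$ is adjacent to exactly $v_n$ and $v_1$. Thus $S_n$ has $2n$ vertices and $n(n-1)/2 + 2n$ edges. -}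

module Defs where

open import Data.Empty using (⊥)
open import Data.Fin using (Fin; toℕ)
open import Data.Fin.Properties using (+↔⊎)
open import Data.Nat using (ℕ; suc; _+_; _≤_)
open import Data.Nat.Properties using (≤-antisym)
open import Data.Product using (∃; _×_; _,_)
open import Data.Sum using (_⊎_; inj₁; inj₂)
open import Function.Bundles using (_↔_)
open import Relation.Binary.Definitions using (Symmetric)
open import Relation.Binary.PropositionalEquality using (_≡_; _≢_; refl; ≢-sym)
open import Relation.Nullary using (¬_)

record FiniteSimpleGraph : Set₁ where
  field
    Vertex    : Set
    Adj       : Vertex → Vertex → Set
    order     : ℕ
    enumerate : Fin order ↔ Vertex
    adj-sym   : Symmetric Adj
    adj-irr   : ∀ x → ¬ Adj x x

module _ (G : FiniteSimpleGraph) where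
  open FiniteSimpleGraph G

  IsProper : ∀ {k} → (Vertex → Fin k) → Set
  IsProper c = ∀ {x y} → Adj x y → c x ≢ c y

  -- Pairs of adjacent vertices are unordered.  Since i ≢ j, a pair coloured
  -- with i and j has exactly one ordering whose first vertex has colour i, so
  -- two such pairs coincide exactly when they agree componentwise.
  AtMostOnePair : ∀ {k} → (Vertex → Fin k) → Fin k → Fin k → Set
  AtMostOnePair c i j = ∀ {x y x′ y′} →
    Adj x y   → c x  ≡ i → c y  ≡ j →
    Adj x′ y′ → c x′ ≡ i → c y′ ≡ j →
    x ≡ x′ × y ≡ y′

  IsHarmonious : ∀ {k} → (Vertex → Fin k) → Set
  IsHarmonious c = IsProper c × (∀ i j → i ≢ j → AtMostOnePair c i j)

  HarmoniouslyColorable : ℕ → Set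
  HarmoniouslyColorable k = ∃ λ (c : Vertex → Fin k) → IsHarmonious c

  -- h(G) = k, as a relation: k is the least positive number of colours.
  IsHarmoniousChromaticNumber : ℕ → Set
  IsHarmoniousChromaticNumber k =
    1 ≤ k × HarmoniouslyColorable k ×
    (∀ m → 1 ≤ m → HarmoniouslyColorable m → k ≤ m)

  harmoniousChromaticNumber-unique : ∀ {k l} →
    IsHarmoniousChromaticNumber k → IsHarmoniousChromaticNumber l → k ≡ l
  harmoniousChromaticNumber-unique (1≤k , ck , mink) (1≤l , cl , minl) =
    ≤-antisym (mink _ 1≤l cl) (minl _ 1≤k ck)

-- Indices are 0-based: v i and u i stand for the vertices usually written
-- v_{i+1} and u_{i+1}.
SunVertex : ℕ → Set
SunVertex n = Fin n ⊎ Fin n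

pattern v i = inj₁ i
pattern u i = inj₂ i

CyclicSuc : ∀ {n} → Fin n → Fin n → Set
CyclicSuc {n} i j =
  toℕ j ≡ suc (toℕ i) ⊎ (suc (toℕ i) ≡ n × toℕ j ≡ 0)

SunAdj : ∀ n → SunVertex n → SunVertex n → Set
SunAdj n (v i) (v j) = i ≢ j
SunAdj n (u i) (v j) = j ≡ i ⊎ CyclicSuc i j
SunAdj n (v j) (u i) = j ≡ i ⊎ CyclicSuc i j
SunAdj n (u _) (u _) = ⊥

sunAdj-sym : ∀ n → Symmetric (SunAdj n)
sunAdj-sym n {v _} {v _} i≢j = ≢-sym i≢j
sunAdj-sym n {v _} {u _} a   = a
sunAdj-sym n {u _} {v _} a   = a

sunAdj-irr : ∀ n x → ¬ SunAdj n x x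
sunAdj-irr n (v _) i≢i = i≢i refl
sunAdj-irr n (u _) ()

sun : ℕ → FiniteSimpleGraph
sun n = record
  { Vertex    = SunVertex n
  ; Adj       = SunAdj n
  ; order     = n + n
  ; enumerate = +↔⊎
  ; adj-sym   = λ {x} {y} → sunAdj-sym n {x} {y}
  ; adj-irr   = sunAdj-irr n
  }

{-# OPTIONS --safe #-}

-- In a harmonious colouring of the sun the clique takes n colours, and no
-- clique colour recurs on a u i, since all clique colours are already joined.
-- Two of the u's may share a colour exactly when they have no common neighbour.
-- Since u i and u j (i ≠ j) have a common neighbour exactly when i and j are consecutive
-- on the n-cycle, the harmonious chromatic number is n plus the chromatic number
-- of the n-cycle.
module Submission where

open import Data.Empty using (⊥-elim)
open import Data.Fin using (Fin; zero; suc; toℕ; fromℕ; fromℕ<; _↑ˡ_; _↑ʳ_; splitAt)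
open import Data.Fin.Properties
  using (toℕ-injective; toℕ-fromℕ; toℕ-fromℕ<; toℕ<n; _≟_;
         ↑ˡ-injective; ↑ʳ-injective; splitAt-↑ˡ; splitAt-↑ʳ; +↔⊎; injective⇒≤)
import Data.Fin.Properties as Fin
open import Data.Nat using (ℕ; zero; suc; _+_; _*_; _≤_; _<_; s≤s; z<s)
open import Data.Nat.Divisibility using (_∣_; _∤_; divides; _∣0; ∣-refl; ∣m∣n⇒∣m+n)
open import Data.Nat.Properties using (suc-injective; ≤-trans; ≤-reflexive; <⇒≤; 1+n≢n)
open import Data.Product using (∃; _×_; _,_; proj₁; proj₂)
open import Data.Sum using (_⊎_; inj₁; inj₂; [_,_]′)
open import Data.Vec using (Vec; []; _∷_; map; lookup)
open import Data.Vec.Properties using (lookup-map)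
open import Data.Vec.Relation.Unary.All using ([]; _∷_)
open import Data.Vec.Relation.Unary.Unique.Propositional using (Unique; []; _∷_)
open import Data.Vec.Relation.Unary.Unique.Propositional.Properties using (lookup-injective)
open import Function using (_∘_)
open import Function.Bundles using (Injection)
open import Function.Properties.Inverse using (↔⇒↣)
open import Relation.Binary.PropositionalEquality
  using (_≡_; _≢_; refl; sym; trans; cong; ≢-sym; module ≡-Reasoning)
open import Relation.Nullary using (yes; no)
open import Defs

even-or-suc-even : ∀ n → 2 ∣ n ⊎ 2 ∣ suc n
even-or-suc-even zero    = inj₁ (2 ∣0)
even-or-suc-even (suc n) =
  [ (λ 2∣n → inj₂ (∣m∣n⇒∣m+n ∣-refl 2∣n)) , inj₁ ]′ (even-or-suc-even n)

CyclicSuc-injective : ∀ {n} {i j k : Fin n} → CyclicSuc i k → CyclicSuc j k → i ≡ j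
CyclicSuc-injective (inj₁ p) (inj₁ q) = toℕ-injective (suc-injective (trans (sym p) q))
CyclicSuc-injective (inj₁ p) (inj₂ (_ , q)) with () ← trans (sym p) q
CyclicSuc-injective (inj₂ (_ , p)) (inj₁ q) with () ← trans (sym p) q
CyclicSuc-injective (inj₂ (p , _)) (inj₂ (q , _)) =
  toℕ-injective (suc-injective (trans p (sym q)))

-- Length at least two matters: on a cycle of length one the only index succeeds itself.
CyclicSuc-irreflexive : ∀ {n} {i j : Fin (2 + n)} → CyclicSuc i j → i ≢ j
CyclicSuc-irreflexive (inj₁ p) refl = 1+n≢n (sym p)
CyclicSuc-irreflexive {i = zero} (inj₂ (() , _)) refl

-- For `n` at least 3, a proper colouring of the `n`-cycle; `CyclicSuc` meets each edge in one
-- direction, which suffices as `≢` is symmetric.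
IsCycleColoring : ∀ {n} {A : Set} → (Fin n → A) → Set
IsCycleColoring f = ∀ {i j} → CyclicSuc i j → f i ≢ f j

alternate : ℕ → Fin 2
alternate 0             = zero
alternate 1             = suc zero
alternate (suc (suc n)) = alternate n

alternate-step : ∀ n → alternate n ≢ alternate (suc n)
alternate-step 0             ()
alternate-step 1             ()
alternate-step (suc (suc n)) = alternate-step n

alternate-even : ∀ q → alternate (q * 2) ≡ zero
alternate-even zero    = refl
alternate-even (suc q) = alternate-even q

twoColoring : ∀ {n} → Fin n → Fin 2
twoColoring i = alternate (toℕ i)

twoColoring-isCycleColoring : ∀ {n} → 2 ∣ n → IsCycleColoring (twoColoring {n})
twoColoring-isCycleColoring _ {i} {j} (inj₁ p) rewrite p = alternate-step (toℕ i)
-- The closing edge: one step past the last index is `q * 2`, where the alternation is back at the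
-- colour of index 0.
twoColoring-isCycleColoring (divides q refl) {i} {j} (inj₂ (p , j≡0)) eq =
  alternate-step (toℕ i) (begin
    alternate (toℕ i)       ≡⟨ eq ⟩
    alternate (toℕ j)       ≡⟨ cong alternate j≡0 ⟩
    zero                    ≡⟨ alternate-even q ⟨
    alternate (q * 2)       ≡⟨ cong alternate p ⟨
    alternate (suc (toℕ i)) ∎)
  where open ≡-Reasoning

-- Index 0 has a colour of its own, so the closing edge is harmless and the other indices form a
-- path, on which two alternating colours do.
threeColoring : ∀ {n} → Fin n → Fin 3
threeColoring zero    = zero
threeColoring (suc i) = suc (alternate (toℕ i))

threeColoring-isCycleColoring : ∀ {n} → IsCycleColoring (threeColoring {2 + n})
threeColoring-isCycleColoring {i = zero}  {suc _} _ ()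
threeColoring-isCycleColoring {i = suc _} {zero}  _ ()
threeColoring-isCycleColoring {i = zero}  {zero}  c = ⊥-elim (CyclicSuc-irreflexive c refl)
threeColoring-isCycleColoring {i = suc i} {suc j} (inj₁ p)
  rewrite suc-injective p = alternate-step (toℕ i) ∘ Fin.suc-injective

-- Distinct values are recorded by positions attaining them, so that they can be looked up as
-- vertices when colours are counted.
ManyValues : ∀ {n} {A : Set} → ℕ → (Fin n → A) → Set
ManyValues {n} r f = ∃ λ (is : Vec (Fin n) r) → Unique (map f is)

twoValues : ∀ {n} {A : Set} {f : Fin (2 + n) → A} → IsCycleColoring f → ManyValues 2 f
twoValues col = zero ∷ suc zero ∷ [] , (col (inj₁ refl) ∷ []) ∷ [] ∷ []

CyclicSuc-predecessor : ∀ {n m} (i : Fin n) → toℕ i ≡ suc m →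
  ∃ λ j → toℕ j ≡ m × CyclicSuc j i
CyclicSuc-predecessor {n} {m} i eq =
  fromℕ< m<n , toℕ-fromℕ< m<n , inj₁ (trans eq (cong suc (sym (toℕ-fromℕ< m<n))))
  where
  m<n : m < n
  m<n = ≤-trans (≤-reflexive (sym eq)) (<⇒≤ (toℕ<n i))

-- Three consecutive vertices either get three colours or the first and third
-- agree, so avoiding three colours forces all even positions to agree.
even-positions : ∀ {n k} {f : Fin (suc n) → Fin k} → IsCycleColoring f →
  ∀ q i → toℕ i ≡ q * 2 → f i ≡ f zero ⊎ ManyValues 3 f
even-positions col zero zero refl = inj₁ refl
even-positions {f = f} col (suc q) i eq
  with b , b-pos , b→i ← CyclicSuc-predecessor i eq
  with a , a-pos , a→b ← CyclicSuc-predecessor b b-pos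
  with f i ≟ f a
... | no  fi≢fa =
  inj₂ (i ∷ a ∷ b ∷ [] , (fi≢fa ∷ ≢-sym (col b→i) ∷ []) ∷ (col a→b ∷ []) ∷ [] ∷ [])
... | yes fi≡fa with even-positions col q a a-pos
...   | inj₁ fa≡f0 = inj₁ (trans fi≡fa fa≡f0)
...   | inj₂ three = inj₂ three

-- In an odd cycle the last position `n` is even, so with fewer than three values it would share the
-- colour of its successor 0.
threeValues : ∀ {n k} {f : Fin (suc n) → Fin k} → 2 ∤ suc n → IsCycleColoring f → ManyValues 3 f
threeValues {n} odd col with even-or-suc-even n
... | inj₂ even = ⊥-elim (odd even)
... | inj₁ (divides q n≡q*2)
  with even-positions col q (fromℕ n) (trans (toℕ-fromℕ n) n≡q*2)
...   | inj₁ last≡first = ⊥-elim (col (inj₂ (cong suc (toℕ-fromℕ n) , refl)) last≡first)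
...   | inj₂ three      = three

sun-colorable : ∀ {n r} {p : Fin n → Fin r} → IsCycleColoring p →
  HarmoniouslyColorable (sun n) (n + r)
sun-colorable {n} {r} {p} col = c , proper , pairs
  where
  c : SunVertex n → Fin (n + r)
  c (v i) = i ↑ˡ r
  c (u i) = n ↑ʳ p i

  ↑ˡ≢↑ʳ : ∀ {i : Fin n} {j : Fin r} → i ↑ˡ r ≢ n ↑ʳ j
  ↑ˡ≢↑ʳ {i} {j} eq
    with () ← trans (sym (splitAt-↑ˡ n i r)) (trans (cong (splitAt n) eq) (splitAt-↑ʳ n r j))

  v-injective : ∀ {i j} → c (v i) ≡ c (v j) → i ≡ j
  v-injective = ↑ˡ-injective r _ _

  -- The `u`-neighbours of `v k` have index `k` or its predecessor, and `p` separates consecutive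
  -- indices.
  u-injective : ∀ {i j k} → SunAdj n (v k) (u i) → SunAdj n (v k) (u j) →
    c (u i) ≡ c (u j) → i ≡ j
  u-injective (inj₁ refl) (inj₁ refl) _  = refl
  u-injective (inj₁ refl) (inj₂ s)    eq = ⊥-elim (col s (sym (↑ʳ-injective n _ _ eq)))
  u-injective (inj₂ s)    (inj₁ refl) eq = ⊥-elim (col s (↑ʳ-injective n _ _ eq))
  u-injective (inj₂ s)    (inj₂ t)    _  = CyclicSuc-injective s t

  proper : IsProper (sun n) c
  proper {v _} {v _} i≢j eq = i≢j (v-injective eq)
  proper {v _} {u _} _   eq = ↑ˡ≢↑ʳ eq
  proper {u _} {v _} _   eq = ↑ˡ≢↑ʳ (sym eq)

  -- The colour block tells a `v` from a `u`, so mixed cases clash. Every edge has a `v` end, fixed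
  -- by its colour; a `u` end is then settled among the neighbours of that `v`.
  same : ∀ x y x′ y′ → SunAdj n x y → SunAdj n x′ y′ →
    c x ≡ c x′ → c y ≡ c y′ → x ≡ x′ × y ≡ y′
  same (v _) (v _) (v _) (v _) _ _ p q = cong v (v-injective p) , cong v (v-injective q)
  same (v i) (u _) (v j) (u _) a b p q with refl ← v-injective p =
    refl , cong u (u-injective a b q)
  same (u _) (v i) (u _) (v j) a b p q with refl ← v-injective q =
    cong u (u-injective a b p) , refl
  same (v _) _     (u _) _     _ _ p _ = ⊥-elim (↑ˡ≢↑ʳ p)
  same (u _) _     (v _) _     _ _ p _ = ⊥-elim (↑ˡ≢↑ʳ (sym p))
  same _     (v _) _     (u _) _ _ _ q = ⊥-elim (↑ˡ≢↑ʳ q)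
  same _     (u _) _     (v _) _ _ _ q = ⊥-elim (↑ˡ≢↑ʳ (sym q))

  pairs : ∀ i j → i ≢ j → AtMostOnePair (sun n) c i j
  pairs _ _ _ {x} {y} {x′} {y′} a p q a′ p′ q′ =
    same x y x′ y′ a a′ (trans p (sym p′)) (trans q (sym q′))

module _ {n k} {c : SunVertex n → Fin k} (harm : IsHarmonious (sun n) c) where

  private
    proper : ∀ x y → SunAdj n x y → c x ≢ c y
    proper x y = proj₁ harm {x} {y}

    -- The edges from `x` and `y` to `z` would carry the same pair of colours, hence coincide.
    common-neighbour : ∀ x y z → SunAdj n x z → SunAdj n y z → c x ≡ c y → x ≡ y
    common-neighbour x y z a b eq =
      proj₁ (proj₂ harm (c x) (c z) (proper x z a) {x} {z} {y} {z}
               a refl refl b (sym eq) refl)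

  v-colors-injective : ∀ {i j} → c (v i) ≡ c (v j) → i ≡ j
  v-colors-injective {i} {j} eq with i ≟ j
  ... | yes i≡j = i≡j
  ... | no  i≢j = ⊥-elim (proper (v i) (v j) i≢j eq)

  -- Either the two vertices are adjacent, or `v j` is a common neighbour and would force a `v` to
  -- equal a `u`.
  v-color≢u-color : ∀ {i j} → c (v i) ≢ c (u j)
  v-color≢u-color {i} {j} eq with i ≟ j
  ... | yes refl = proper (v i) (u i) (inj₁ refl) eq
  ... | no  i≢j with () ← common-neighbour (v i) (u j) (v j) i≢j (inj₁ refl) eq

  -- Consecutive `u i` and `u j` share the neighbour `v j`, so equal colours would give `i ≡ j`,
  -- against `irr`.
  u-colors-cycle : (∀ {i j} → CyclicSuc {n} i j → i ≢ j) → IsCycleColoring (c ∘ inj₂)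
  u-colors-cycle irr {i} {j} s eq
    with refl ← common-neighbour (u i) (u j) (v j) (inj₂ s) (inj₁ refl) eq = irr s refl

  -- The `n` clique colours and the `r` chosen `u` colours are pairwise distinct, which embeds
  -- `Fin (n + r)` in `Fin k`.
  colors-≥ : ∀ {r} → ManyValues r (c ∘ inj₂) → n + r ≤ k
  colors-≥ {r} (is , unique) = injective⇒≤ {f = f ∘ splitAt n} λ eq →
    Injection.injective (↔⇒↣ +↔⊎) (f-injective _ _ eq)
    where
    f : Fin n ⊎ Fin r → Fin k
    f (inj₁ i) = c (v i)
    f (inj₂ j) = c (u (lookup is j))

    f-injective : ∀ x y → f x ≡ f y → x ≡ y
    f-injective (inj₁ _) (inj₁ _) eq = cong inj₁ (v-colors-injective eq)
    f-injective (inj₁ _) (inj₂ _) eq = ⊥-elim (v-color≢u-color eq)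
    f-injective (inj₂ _) (inj₁ _) eq = ⊥-elim (v-color≢u-color (sym eq))
    f-injective (inj₂ i) (inj₂ j) eq = cong inj₂ (lookup-injective unique i j
      (trans (lookup-map i _ is) (trans eq (sym (lookup-map j _ is)))))

theorem21 : ∀ (n : ℕ) → 3 ≤ n →
    (2 ∣ n → IsHarmoniousChromaticNumber (sun n) (n + 2)) ×
    (2 ∤ n → IsHarmoniousChromaticNumber (sun n) (n + 3))
theorem21 (suc zero)    (s≤s ())
theorem21 (suc (suc _)) _ =
  (λ even → z<s , sun-colorable (twoColoring-isCycleColoring even) ,
     λ { _ _ (_ , harm) → colors-≥ harm (twoValues (u-colors-cycle harm CyclicSuc-irreflexive)) }) ,
  (λ odd → z<s , sun-colorable threeColoring-isCycleColoring ,
     λ { _ _ (_ , harm) → colors-≥ harm (threeValues odd (u-colors-cycle harm CyclicSuc-irreflexive)) })
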